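{- For every BAO-complex spi-rule logic $rL$, the following are equivalent: (i) $rL$ is complex; (ii) $rL$ is globally complete; (iii) $rL$ is BAO-rule-conservative; (iv) $rL$ is BAO-embeddable.
   Context: Fix a signature $\mathcal R$ with diamonds $\Diamond_R$. Sp-formulas: built from propositional variables and $\top$ by $\wedge$ and the $\Diamond_R$; sp-implications $\sigma\to\tau$. A SLO is an algebra $(A,\wedge,\top,\Diamond_R)_R$ with $(A,\wedge,\top)$ a meet-semilattice with top and each $\Diamond_R$ monotone. A BAO is an algebra $(A,\wedge,\vee,-,\bot,\top,\Diamond_R)_R$ that is a Boolean algebra with operators satisfying $\Diamond_R\bot=\bot$ and $\Diamond_R(a\vee b)=\Diamond_Ra\vee\Diamond_Rb$; its sp-type reduct is $(A,\wedge,\top,\Diamond_R)_R$. For a frame $\mathfrak F=(W,R^{\mathfrak F})_R$, $\mathfrak F^\star=(2^W,\cap,W,\Diamond_R^+)_R$ with $\Diamond_R^+X=\{w\mid\exists v\in X,(w,v)\in R^{\mathfrak F}\}$ (the sp-type reduct of the full complex algebra of $\mathfrak F$); $\mathsf{CA}=\{\mathfrak F^\star\mid\mathfrak F\text{ a frame}\}$. An embedding is an injective map preserving $\wedge,\top$ and all $\Diamond_R$. An spi-rule is $\rho=\frac{\iota_1,\dots,\iota_n}{\iota}$ with sp-implications $\iota_1,\dots,\iota_n,\iota$ ($n\ge0$). An algebra $\mathfrak A$ with an sp-type reduct validates $\rho$ if for every valuation $\mathfrak a$ in $\mathfrak A$: whenever $\sigma_i[\mathfrak a]\le\tau_i[\mathfrak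 a]$ for all $\iota_i=(\sigma_i\to\tau_i)$, also $\sigma[\mathfrak a]\le\tau[\mathfrak a]$ for $\iota=(\sigma\to\tau)$. A rule holds in a Kripke model if $\iota$ is true at all points whenever each $\iota_i$ is true at all points; a frame validates $\rho$ if $\rho$ holds in every model over it. An spi-rule logic is a set $rL=\{\rho\mid\mathfrak A\models\rho\text{ for all }\mathfrak A\in\mathcal K\}$ for some class $\mathcal K$ of SLOs. $\mathsf{Kr}_{rL}$ is the class of frames validating all rules in $rL$. For a class $\mathcal C$ of algebras with sp-type reducts, $\mathcal C_{rL}=\{\mathfrak A\in\mathcal C\mid\mathfrak A\models\rho\ \forall\rho\in rL\}$ and $rL\models_{\mathcal C}\rho$ iff every $\mathfrak A\in\mathcal C_{rL}$ validates $\rho$; $\mathsf{SLO}$ and $\mathsf{BAO}$ denote the classes of all SLOs and all BAOs. $rL$ is $\mathcal C$-embeddable if every SLO in $\mathsf{SLO}_{rL}$ embeds into the sp-type reduct of some $\mathfrak B\in\mathcal C_{rL}$; $\mathcal C$-rule-conservative if $rL\models_{\mathcal C}\rho$ implies $rL\models_{\mathsf{SLO}}\rho$ for every spi-rule $\rho$. $rL$ is complex if it is $\mathsf{CA}$-embeddable, globally complete if it is $\mathsf{CA}$-rule-conservative, and BAO-complex if the sp-type reduct of every $\mathfrak A\in\mathsf{BAO}_{rL}$ embeds into some $\mathfrak F^\star$ with $\mathfrak F\in\mathsf{Kr}_{rL}$. -}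

module Defs where

open import Algebra.Bundles.Raw using (RawMonoid)
open import Algebra.Core using (Op₁; Op₂)
open import Algebra.Lattice.Structures using (IsBoundedMeetSemilattice; IsBooleanAlgebra)
open import Algebra.Morphism.Structures using (IsMonoidMonomorphism)
open import Axiom.ExcludedMiddle using (ExcludedMiddle)
open import Data.Bool.Base using (Bool; true) renaming (_∧_ to _&&_)
open import Data.List.Base using (List)
open import Data.List.Relation.Unary.All using (All)
open import Data.Nat.Base using (ℕ)
open import Data.Product.Base using (∃; _×_)
open import Data.Unit.Polymorphic.Base using (⊤)
open import Level using (Level; Lift; _⊔_; suc)
open import Relation.Binary.Core using (Rel)
open import Relation.Binary.PropositionalEquality.Core using (_≡_; _≗_)
open import Relation.Nullary.Decidable.Core using (does)
open import Relation.Unary using (Pred)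

private
  variable
    ℓ r k : Level

infixr 6 _∧ᶠ_
infix  4 _⟶_

data Formula (ℛ : Set ℓ) : Set ℓ where
  var  : ℕ → Formula ℛ
  ⊤ᶠ   : Formula ℛ
  _∧ᶠ_ : Formula ℛ → Formula ℛ → Formula ℛ
  ◇ᶠ   : ℛ → Formula ℛ → Formula ℛ

record Implication (ℛ : Set ℓ) : Set ℓ where
  constructor _⟶_
  field
    antecedent : Formula ℛ
    consequent : Formula ℛ

record Rule (ℛ : Set ℓ) : Set ℓ where
  field
    premises   : List (Implication ℛ)
    conclusion : Implication ℛ

-- An algebra of the sp-type, without any laws. As usual in the standard
-- library, equality in the algebra is a designated relation _≈_.
record SpAlgebra (ℛ : Set ℓ) : Set (suc ℓ) where
  infix  4 _≈_ _≤_
  infixr 7 _∧_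
  field
    Carrier : Set ℓ
    _≈_     : Rel Carrier ℓ
    _∧_     : Op₂ Carrier
    top     : Carrier
    ◇       : ℛ → Op₁ Carrier

  _≤_ : Rel Carrier ℓ
  x ≤ y = x ∧ y ≈ x

  rawMonoid : RawMonoid ℓ ℓ
  rawMonoid = record { Carrier = Carrier ; _≈_ = _≈_ ; _∙_ = _∧_ ; ε = top }

  ⟦_⟧ : Formula ℛ → (ℕ → Carrier) → Carrier
  ⟦ var p ⟧   𝔞 = 𝔞 p
  ⟦ ⊤ᶠ ⟧      𝔞 = top
  ⟦ φ ∧ᶠ ψ ⟧  𝔞 = ⟦ φ ⟧ 𝔞 ∧ ⟦ ψ ⟧ 𝔞
  ⟦ ◇ᶠ R φ ⟧  𝔞 = ◇ R (⟦ φ ⟧ 𝔞)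

  Holds : (ℕ → Carrier) → Implication ℛ → Set ℓ
  Holds 𝔞 (σ ⟶ τ) = ⟦ σ ⟧ 𝔞 ≤ ⟦ τ ⟧ 𝔞

infix 4 _⊨_ _⊨ˢ_ _⊩_ _↪_

_⊨_ : {ℛ : Set ℓ} → SpAlgebra ℛ → Rule ℛ → Set ℓ
𝔄 ⊨ ρ = ∀ 𝔞 → All (Holds 𝔞) (Rule.premises ρ) → Holds 𝔞 (Rule.conclusion ρ)
  where open SpAlgebra 𝔄

_⊨ˢ_ : {ℛ : Set ℓ} → SpAlgebra ℛ → Pred (Rule ℛ) r → Set (ℓ ⊔ r)
𝔄 ⊨ˢ rL = ∀ ρ → rL ρ → 𝔄 ⊨ ρ

record SLO (ℛ : Set ℓ) : Set (suc ℓ) where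
  field
    spAlgebra : SpAlgebra ℛ
  open SpAlgebra spAlgebra public
  field
    isBoundedMeetSemilattice : IsBoundedMeetSemilattice _≈_ _∧_ top
    ◇-mono : ∀ R {x y} → x ≤ y → ◇ R x ≤ ◇ R y

record BAO (ℛ : Set ℓ) : Set (suc ℓ) where
  infix  4 _≈_
  infixr 7 _∧_
  infixr 6 _∨_
  field
    Carrier  : Set ℓ
    _≈_      : Rel Carrier ℓ
    _∧_ _∨_  : Op₂ Carrier
    -_       : Op₁ Carrier
    bot top  : Carrier
    ◇        : ℛ → Op₁ Carrier
    isBooleanAlgebra : IsBooleanAlgebra _≈_ _∨_ _∧_ -_ top bot
    ◇-cong   : ∀ R {x y} → x ≈ y → ◇ R x ≈ ◇ R y
    ◇-bot    : ∀ R → ◇ R bot ≈ bot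
    ◇-join   : ∀ R x y → ◇ R (x ∨ y) ≈ ◇ R x ∨ ◇ R y

  reduct : SpAlgebra ℛ
  reduct = record { Carrier = Carrier ; _≈_ = _≈_ ; _∧_ = _∧_ ; top = top ; ◇ = ◇ }

record _↪_ {ℛ : Set ℓ} (𝔄 𝔅 : SpAlgebra ℛ) : Set ℓ where
  private
    module A = SpAlgebra 𝔄
    module B = SpAlgebra 𝔅
  field
    to : A.Carrier → B.Carrier
    isMonoidMonomorphism : IsMonoidMonomorphism A.rawMonoid B.rawMonoid to
    ◇-homo : ∀ R x → to (A.◇ R x) B.≈ B.◇ R (to x)

record Frame (ℛ : Set ℓ) : Set (suc ℓ) where
  field
    W   : Set ℓ
    rel : ℛ → Rel W ℓ

  -- Subsets are Bool-valued, so that 2^W lies in the same universe as W. With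
  -- Set ℓ-valued subsets the powerset would be one universe up, and an algebra
  -- of that size could not embed into the powerset of any W : Set ℓ.
  Subset : Set ℓ
  Subset = W → Bool

  Truth : (ℕ → Subset) → W → Formula ℛ → Set ℓ
  Truth V w (var p)   = Lift ℓ (V p w ≡ true)
  Truth V w ⊤ᶠ        = ⊤
  Truth V w (φ ∧ᶠ ψ)  = Truth V w φ × Truth V w ψ
  Truth V w (◇ᶠ R φ)  = ∃ λ v → rel R w v × Truth V v φ

  TrueEverywhere : (ℕ → Subset) → Implication ℛ → Set ℓ
  TrueEverywhere V (σ ⟶ τ) = ∀ w → Truth V w σ → Truth V w τ

_⊩_ : {ℛ : Set ℓ} → Frame ℛ → Rule ℛ → Set ℓ
𝔉 ⊩ ρ = ∀ V → All (TrueEverywhere V) (Rule.premises ρ) → TrueEverywhere V (Rule.conclusion ρ)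
  where open Frame 𝔉

Kr : {ℛ : Set ℓ} → Pred (Rule ℛ) r → Pred (Frame ℛ) (ℓ ⊔ r)
Kr rL 𝔉 = ∀ ρ → rL ρ → 𝔉 ⊩ ρ

-- Excluded middle turns { w ∣ ∃ v ∈ X, (w , v) ∈ R } into a Bool-valued subset.
complexAlgebra : {ℛ : Set ℓ} → ExcludedMiddle ℓ → Frame ℛ → SpAlgebra ℛ
complexAlgebra em 𝔉 = record
  { Carrier = Subset
  ; _≈_     = _≗_
  ; _∧_     = λ X Y w → X w && Y w
  ; top     = λ _ → true
  ; ◇       = λ R X w → does (em {∃ λ v → rel R w v × X v ≡ true})
  }
  where open Frame 𝔉

-- A class of algebras with sp-type reducts. The members may carry further
-- structure, which an embedding into the reduct ignores.
record AlgebraClass (ℛ : Set ℓ) : Set (suc (suc ℓ)) where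
  field
    Member   : Set (suc ℓ)
    reductOf : Member → SpAlgebra ℛ

SLOs : (ℛ : Set ℓ) → AlgebraClass ℛ
SLOs ℛ = record { Member = SLO ℛ ; reductOf = SLO.spAlgebra }

BAOs : (ℛ : Set ℓ) → AlgebraClass ℛ
BAOs ℛ = record { Member = BAO ℛ ; reductOf = BAO.reduct }

CA : ExcludedMiddle ℓ → (ℛ : Set ℓ) → AlgebraClass ℛ
CA em ℛ = record { Member = Frame ℛ ; reductOf = complexAlgebra em }

ruleLogic : {ℛ : Set ℓ} → Pred (SLO ℛ) k → Pred (Rule ℛ) (suc ℓ ⊔ k)
ruleLogic 𝒦 ρ = ∀ 𝔄 → 𝒦 𝔄 → SLO.spAlgebra 𝔄 ⊨ ρ

Entails : {ℛ : Set ℓ} → AlgebraClass ℛ → Pred (Rule ℛ) r → Rule ℛ → Set (suc ℓ ⊔ r)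
Entails 𝒞 rL ρ = ∀ 𝔄 → reductOf 𝔄 ⊨ˢ rL → reductOf 𝔄 ⊨ ρ
  where open AlgebraClass 𝒞

Embeddable : {ℛ : Set ℓ} → AlgebraClass ℛ → Pred (Rule ℛ) r → Set (suc ℓ ⊔ r)
Embeddable {ℛ = ℛ} 𝒞 rL =
  ∀ (𝔄 : SLO ℛ) → SLO.spAlgebra 𝔄 ⊨ˢ rL →
  ∃ λ 𝔅 → reductOf 𝔅 ⊨ˢ rL × (SLO.spAlgebra 𝔄 ↪ reductOf 𝔅)
  where open AlgebraClass 𝒞

RuleConservative : {ℛ : Set ℓ} → AlgebraClass ℛ → Pred (Rule ℛ) r → Set (suc ℓ ⊔ r)
RuleConservative {ℛ = ℛ} 𝒞 rL = ∀ ρ → Entails 𝒞 rL ρ → Entails (SLOs ℛ) rL ρ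

Complex : {ℛ : Set ℓ} → ExcludedMiddle ℓ → Pred (Rule ℛ) r → Set (suc ℓ ⊔ r)
Complex {ℛ = ℛ} em = Embeddable (CA em ℛ)

GloballyComplete : {ℛ : Set ℓ} → ExcludedMiddle ℓ → Pred (Rule ℛ) r → Set (suc ℓ ⊔ r)
GloballyComplete {ℛ = ℛ} em = RuleConservative (CA em ℛ)

BAO-Complex : {ℛ : Set ℓ} → ExcludedMiddle ℓ → Pred (Rule ℛ) r → Set (suc ℓ ⊔ r)
BAO-Complex {ℛ = ℛ} em rL =
  ∀ (𝔄 : BAO ℛ) → BAO.reduct 𝔄 ⊨ˢ rL →
  ∃ λ 𝔉 → Kr rL 𝔉 × (BAO.reduct 𝔄 ↪ complexAlgebra em 𝔉)

{-# OPTIONS --safe #-}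
-- The only implication that is not bookkeeping is from BAO-rule-conservativity
-- to BAO-embeddability. Given an SLO 𝔄 validating rL, let 𝔅 be the algebra of
-- BAO-terms over the elements of 𝔄, where two terms are identified if some
-- finite part of the diagram of 𝔄 forces them to be equal in every BAO
-- validating rL. Since rules have finitely many premises, 𝔅 is itself a BAO
-- validating rL, and 𝔄 maps homomorphically to it. If generators a and b are
-- identified by a finite part Γ of the diagram, then the spi-rules Γ / a → b and
-- Γ / b → a are valid in all BAOs validating rL, hence by conservativity in 𝔄,
-- where Γ holds; so a and b are equal in 𝔄. No ultraproducts, and hence no
-- choice, are needed.
module Submission where

open import Algebra.Lattice.Structures using (IsBooleanAlgebra; module IsBoundedMeetSemilattice)
import Algebra.Lattice.Properties.Lattice as LatticeProperties
import Algebra.Morphism.Construct.Composition as Composition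
open import Algebra.Morphism.Structures using (module IsMonoidMonomorphism)
open import Axiom.ExcludedMiddle using (ExcludedMiddle)
open import Data.Bool.Base using (true; false; not) renaming (_∧_ to _&&_; _∨_ to _||_)
open import Data.Bool.Properties using (∨-∧-isBooleanAlgebra; ∧-conicalˡ; ∧-conicalʳ; ∨-zeroʳ)
open import Data.List.Base using (List; []; _∷_; _++_; [_])
open import Data.List.Relation.Unary.All as All using (All; []; _∷_)
open import Data.List.Relation.Unary.All.Properties using (++⁻ˡ; ++⁻ʳ)
open import Data.Nat.Base using (ℕ; zero; suc)
open import Data.Product using (_×_; _,_; ∃; ∃₂)
open import Data.Sum.Base as Sum using (_⊎_; inj₁; inj₂)
open import Data.Unit.Polymorphic.Base using (tt)
open import Function.Base using (_∘_; id)
open import Function.Bundles using (_⇔_; mk⇔)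
open import Level using (Level; lift; _⊔_) renaming (suc to lsuc)
open import Relation.Binary.PropositionalEquality using (_≡_; refl; sym; trans; cong; cong₂; subst; subst₂)
open import Relation.Nullary.Decidable using (Dec; True; toWitness; fromWitness)
open import Relation.Nullary.Decidable using (does; yes; no; _⊎-dec_; does-⇔; dec-true; dec-false)
open import Relation.Nullary.Negation using (contradiction)
open import Relation.Unary using (Pred)
open import Defs

private
  variable
    ℓ r : Level

module BAOProperties {ℛ : Set ℓ} (𝔅 : BAO ℛ) where
  open BAO 𝔅 public
  open IsBooleanAlgebra isBooleanAlgebra public
    hiding (isEquivalence)
    renaming (refl to ≈-refl; sym to ≈-sym; trans to ≈-trans)
  open SpAlgebra reduct public using (_≤_; ⟦_⟧; Holds)

  ≤-reflexive : ∀ {x y} → x ≈ y → x ≤ y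
  ≤-reflexive x≈y = ≈-trans (∧-congˡ (≈-sym x≈y))
    (LatticeProperties.∧-idem (record { isLattice = isLattice }) _)

  ≤-antisym : ∀ {x y} → x ≤ y → y ≤ x → x ≈ y
  ≤-antisym x≤y y≤x = ≈-trans (≈-sym x≤y) (≈-trans (∧-comm _ _) y≤x)

  ≤-resp-≈ : ∀ {x x′ y y′} → x ≈ x′ → y ≈ y′ → x ≤ y → x′ ≤ y′
  ≤-resp-≈ x≈x′ y≈y′ x≤y =
    ≈-trans (∧-cong (≈-sym x≈x′) (≈-sym y≈y′)) (≈-trans x≤y x≈x′)

module _ {ℛ : Set ℓ} {𝔄 : SpAlgebra ℛ} (𝔅 : BAO ℛ) (f : 𝔄 ↪ BAO.reduct 𝔅) where
  private
    module A = SpAlgebra 𝔄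
    module B = BAOProperties 𝔅
  open _↪_ f
  open IsMonoidMonomorphism isMonoidMonomorphism using (homo; ε-homo; ⟦⟧-cong; injective)

  ↪-⟦⟧ : ∀ 𝔞 φ → to (A.⟦ φ ⟧ 𝔞) B.≈ B.⟦ φ ⟧ (to ∘ 𝔞)
  ↪-⟦⟧ 𝔞 (var p)  = B.≈-refl
  ↪-⟦⟧ 𝔞 ⊤ᶠ       = ε-homo
  ↪-⟦⟧ 𝔞 (φ ∧ᶠ ψ) = B.≈-trans (homo _ _) (B.∧-cong (↪-⟦⟧ 𝔞 φ) (↪-⟦⟧ 𝔞 ψ))
  ↪-⟦⟧ 𝔞 (◇ᶠ R φ) = B.≈-trans (◇-homo R _) (B.◇-cong R (↪-⟦⟧ 𝔞 φ))

  ↪-Holds⁺ : ∀ {𝔞} ι → A.Holds 𝔞 ι → B.Holds (to ∘ 𝔞) ι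
  ↪-Holds⁺ (σ ⟶ τ) σ≤τ = B.≤-resp-≈ (↪-⟦⟧ _ σ) (↪-⟦⟧ _ τ)
    (B.≈-trans (B.≈-sym (homo _ _)) (⟦⟧-cong σ≤τ))

  ↪-Holds⁻ : ∀ {𝔞} ι → B.Holds (to ∘ 𝔞) ι → A.Holds 𝔞 ι
  ↪-Holds⁻ (σ ⟶ τ) σ≤τ = injective (B.≈-trans (homo _ _)
    (B.≤-resp-≈ (B.≈-sym (↪-⟦⟧ _ σ)) (B.≈-sym (↪-⟦⟧ _ τ)) σ≤τ))

  ↪-⊨ : ∀ ρ → BAO.reduct 𝔅 ⊨ ρ → 𝔄 ⊨ ρ
  ↪-⊨ ρ 𝔅⊨ρ 𝔞 premises =
    ↪-Holds⁻ (Rule.conclusion ρ) (𝔅⊨ρ (to ∘ 𝔞) (All.map (λ {ι} → ↪-Holds⁺ ι) premises))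

↪-trans : {ℛ : Set ℓ} {𝔄 𝔅 : SpAlgebra ℛ} (ℭ : BAO ℛ) →
          𝔄 ↪ 𝔅 → 𝔅 ↪ BAO.reduct ℭ → 𝔄 ↪ BAO.reduct ℭ
↪-trans ℭ f g = record
  { to = G.to ∘ F.to
  ; isMonoidMonomorphism = Composition.isMonoidMonomorphism C.≈-trans F.isMonoidMonomorphism G.isMonoidMonomorphism
  ; ◇-homo = λ R x → C.≈-trans (⟦⟧-cong (F.◇-homo R x)) (G.◇-homo R (F.to x))
  }
  where
  module F = _↪_ f
  module G = _↪_ g
  module C = BAOProperties ℭ
  open IsMonoidMonomorphism G.isMonoidMonomorphism using (⟦⟧-cong)

-- Complex algebras of frames

∨-true : ∀ x {y} → x || y ≡ true → x ≡ true ⊎ y ≡ true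
∨-true true  _      = inj₁ refl
∨-true false y≡true = inj₂ y≡true

∧-absorbed⁺ : ∀ {x y} → (x ≡ true → y ≡ true) → x && y ≡ x
∧-absorbed⁺ {false} _ = refl
∧-absorbed⁺ {true}  f = f refl

∧-absorbed⁻ : ∀ {x y} → x && y ≡ x → x ≡ true → y ≡ true
∧-absorbed⁻ x∧y≡x refl = x∧y≡x

does-true⁻ : {P : Set ℓ} (p? : Dec P) → does p? ≡ true → P
does-true⁻ (yes p) _ = p

module _ (em : ∀ {a} → ExcludedMiddle a) {ℛ : Set ℓ} (𝔉 : Frame ℛ) where
  open Frame 𝔉
  private module 𝔉⋆ = SpAlgebra (complexAlgebra em 𝔉)
  open 𝔉⋆ using (⟦_⟧; Holds)

  complexBAO : BAO ℛ
  complexBAO = record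
    { Carrier = Subset
    ; _≈_ = 𝔉⋆._≈_
    ; _∧_ = 𝔉⋆._∧_
    ; top = 𝔉⋆.top
    ; ◇   = 𝔉⋆.◇
    ; _∨_ = λ X Y w → X w || Y w
    ; -_  = λ X w → not (X w)
    ; bot = λ _ → false
    ; isBooleanAlgebra = record
      { isDistributiveLattice = record
        { isLattice = record
          { isEquivalence = record
            { refl = λ _ → refl ; sym = λ p w → sym (p w) ; trans = λ p q w → trans (p w) (q w) }
          ; ∨-comm     = λ X Y w → 𝔹.∨-comm (X w) (Y w)
          ; ∨-assoc    = λ X Y Z w → 𝔹.∨-assoc (X w) (Y w) (Z w)
          ; ∨-cong     = λ p q w → cong₂ _||_ (p w) (q w)
          ; ∧-comm     = λ X Y w → 𝔹.∧-comm (X w) (Y w)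
          ; ∧-assoc    = λ X Y Z w → 𝔹.∧-assoc (X w) (Y w) (Z w)
          ; ∧-cong     = λ p q w → cong₂ _&&_ (p w) (q w)
          ; absorptive = (λ X Y w → 𝔹.∨-absorbs-∧ (X w) (Y w)) , (λ X Y w → 𝔹.∧-absorbs-∨ (X w) (Y w))
          }
        ; ∨-distrib-∧ = (λ X Y Z w → 𝔹.∨-distribˡ-∧ (X w) (Y w) (Z w))
                      , (λ X Y Z w → 𝔹.∨-distribʳ-∧ (X w) (Y w) (Z w))
        ; ∧-distrib-∨ = (λ X Y Z w → 𝔹.∧-distribˡ-∨ (X w) (Y w) (Z w))
                      , (λ X Y Z w → 𝔹.∧-distribʳ-∨ (X w) (Y w) (Z w))
        }
      ; ∨-complement = (λ X w → 𝔹.∨-complementˡ (X w)) , (λ X w → 𝔹.∨-complementʳ (X w))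
      ; ∧-complement = (λ X w → 𝔹.∧-complementˡ (X w)) , (λ X w → 𝔹.∧-complementʳ (X w))
      ; ¬-cong = λ p w → cong not (p w)
      }
    ; ◇-cong = λ R p w → does-⇔
        (mk⇔ (λ (v , wRv , v∈X) → v , wRv , trans (sym (p v)) v∈X)
             (λ (v , wRv , v∈Y) → v , wRv , trans (p v) v∈Y)) em em
    ; ◇-bot  = λ R w → dec-false em λ ()
    ; ◇-join = λ R X Y w → does-⇔
        (mk⇔ (λ (v , wRv , v∈X∨Y) →
               Sum.map (λ v∈X → v , wRv , v∈X) (λ v∈Y → v , wRv , v∈Y) (∨-true (X v) v∈X∨Y))
             (λ { (inj₁ (v , wRv , v∈X)) → v , wRv , cong (_|| Y v) v∈X
                ; (inj₂ (v , wRv , v∈Y)) → v , wRv , trans (cong (X v ||_) v∈Y) (∨-zeroʳ (X v)) }))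
        em (em ⊎-dec em)
    }
    where
    module 𝔹 = IsBooleanAlgebra ∨-∧-isBooleanAlgebra

  Truth⇒⟦⟧ : ∀ V w φ → Truth V w φ → ⟦ φ ⟧ V w ≡ true
  Truth⇒⟦⟧ V w (var p)  (lift w∈p)      = w∈p
  Truth⇒⟦⟧ V w ⊤ᶠ       _               = refl
  Truth⇒⟦⟧ V w (φ ∧ᶠ ψ) (w⊩φ , w⊩ψ)     = cong₂ _&&_ (Truth⇒⟦⟧ V w φ w⊩φ) (Truth⇒⟦⟧ V w ψ w⊩ψ)
  Truth⇒⟦⟧ V w (◇ᶠ R φ) (v , wRv , v⊩φ) = dec-true em (v , wRv , Truth⇒⟦⟧ V v φ v⊩φ)

  ⟦⟧⇒Truth : ∀ V w φ → ⟦ φ ⟧ V w ≡ true → Truth V w φ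
  ⟦⟧⇒Truth V w (var p)  w∈p = lift w∈p
  ⟦⟧⇒Truth V w ⊤ᶠ       _   = tt
  ⟦⟧⇒Truth V w (φ ∧ᶠ ψ) eq  =
    ⟦⟧⇒Truth V w φ (∧-conicalˡ _ _ eq) , ⟦⟧⇒Truth V w ψ (∧-conicalʳ (⟦ φ ⟧ V w) _ eq)
  ⟦⟧⇒Truth V w (◇ᶠ R φ) eq with does-true⁻ em eq
  ... | v , wRv , v∈φ = v , wRv , ⟦⟧⇒Truth V v φ v∈φ

  TrueEverywhere⇒Holds : ∀ V ι → TrueEverywhere V ι → Holds V ι
  TrueEverywhere⇒Holds V (σ ⟶ τ) σ⊆τ w =
    ∧-absorbed⁺ (Truth⇒⟦⟧ V w τ ∘ σ⊆τ w ∘ ⟦⟧⇒Truth V w σ)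

  Holds⇒TrueEverywhere : ∀ V ι → Holds V ι → TrueEverywhere V ι
  Holds⇒TrueEverywhere V (σ ⟶ τ) σ≤τ w =
    ⟦⟧⇒Truth V w τ ∘ ∧-absorbed⁻ (σ≤τ w) ∘ Truth⇒⟦⟧ V w σ

  ⊩⇒⊨ : ∀ ρ → 𝔉 ⊩ ρ → complexAlgebra em 𝔉 ⊨ ρ
  ⊩⇒⊨ ρ 𝔉⊩ρ V premises = TrueEverywhere⇒Holds V (Rule.conclusion ρ)
    (𝔉⊩ρ V (All.map (λ {ι} → Holds⇒TrueEverywhere V ι) premises))

-- Diagrams of SLOs

data Flat (ℛ X : Set ℓ) : Set ℓ where
  el  : X → Flat ℛ X
  one : Flat ℛ X
  and : X → X → Flat ℛ X
  dia : ℛ → X → Flat ℛ X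

module _ {ℛ X : Set ℓ} where

  flatFormula : (X → ℕ) → Flat ℛ X → Formula ℛ
  flatFormula i (el x)    = var (i x)
  flatFormula i one       = ⊤ᶠ
  flatFormula i (and x y) = var (i x) ∧ᶠ var (i y)
  flatFormula i (dia R x) = ◇ᶠ R (var (i x))

  elements : Flat ℛ X → List X
  elements (el x)    = x ∷ []
  elements one       = []
  elements (and x y) = x ∷ y ∷ []
  elements (dia R x) = x ∷ []

  module _ (𝔅 : SpAlgebra ℛ) where
    open SpAlgebra 𝔅 using (Carrier; ◇; _∧_; ⟦_⟧) renaming (top to ⊤ᴮ)

    flatValue : (X → Carrier) → Flat ℛ X → Carrier
    flatValue v (el x)    = v x
    flatValue v one       = ⊤ᴮ
    flatValue v (and x y) = v x ∧ v y
    flatValue v (dia R x) = ◇ R (v x)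

    ⟦flatFormula⟧ : ∀ (i : X → ℕ) 𝔟 f → ⟦ flatFormula i f ⟧ 𝔟 ≡ flatValue (𝔟 ∘ i) f
    ⟦flatFormula⟧ i 𝔟 (el x)    = refl
    ⟦flatFormula⟧ i 𝔟 one       = refl
    ⟦flatFormula⟧ i 𝔟 (and x y) = refl
    ⟦flatFormula⟧ i 𝔟 (dia R x) = refl

    flatValue-local : ∀ {v v′ : X → Carrier} f → All (λ x → v x ≡ v′ x) (elements f) →
                      flatValue v f ≡ flatValue v′ f
    flatValue-local (el x)    (p ∷ [])     = p
    flatValue-local one       []           = refl
    flatValue-local (and x y) (p ∷ q ∷ []) = cong₂ _∧_ p q
    flatValue-local (dia R x) (p ∷ [])     = cong (◇ R) p

data Term (ℛ X : Set ℓ) : Set ℓ where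
  gen       : X → Term ℛ X
  _∧ᵗ_ _∨ᵗ_ : Term ℛ X → Term ℛ X → Term ℛ X
  -ᵗ_       : Term ℛ X → Term ℛ X
  ⊥ᵗ ⊤ᵗ     : Term ℛ X
  ◇ᵗ        : ℛ → Term ℛ X → Term ℛ X

module _ {ℛ X : Set ℓ} (𝔅 : BAO ℛ) (v : X → BAO.Carrier 𝔅) where
  open BAO 𝔅

  value : Term ℛ X → Carrier
  value (gen x)  = v x
  value (t ∧ᵗ u) = value t ∧ value u
  value (t ∨ᵗ u) = value t ∨ value u
  value (-ᵗ t)   = - value t
  value ⊥ᵗ       = bot
  value ⊤ᵗ       = top
  value (◇ᵗ R t) = ◇ R (value t)

module _ (em : ∀ {a} → ExcludedMiddle a) where

  index : {X : Set ℓ} (xs : List X) → X →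
          ∃₂ λ (i : X → ℕ) (e : ℕ → X) → All (λ x → e (i x) ≡ x) xs
  index []       x₀ = (λ _ → zero) , (λ _ → x₀) , []
  index {X = X} (x ∷ xs) x₀ with index xs x₀
  ... | i , e , e∘i≗id = i′ , e′ , head em ∷ All.map (tail em) e∘i≗id
    where
    pick : ∀ {y} → Dec (y ≡ x) → ℕ
    pick     (yes _) = zero
    pick {y} (no _)  = suc (i y)

    i′ : X → ℕ
    i′ y = pick {y} em

    e′ : ℕ → X
    e′ zero    = x
    e′ (suc n) = e n

    head : (x≡x? : Dec (x ≡ x)) → e′ (pick x≡x?) ≡ x
    head (yes _)  = refl
    head (no x≢x) = contradiction refl x≢x

    tail : ∀ {y} (y≡x? : Dec (y ≡ x)) → e (i y) ≡ y → e′ (pick y≡x?) ≡ y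
    tail (yes y≡x) _  = sym y≡x
    tail (no _)    eq = eq

  module FreeExtension {ℛ : Set ℓ} (rL : Pred (Rule ℛ) r) (𝔄 : SLO ℛ) where
    private
      module A where
        open SLO 𝔄 public
        open IsBoundedMeetSemilattice _≈_ isBoundedMeetSemilattice public
          using (idem; comm; ∧-cong)
          renaming (refl to ≈-refl; sym to ≈-sym; trans to ≈-trans; reflexive to ≈-reflexive)

    record Equation : Set ℓ where
      constructor equation
      field
        lhs   : A.Carrier
        rhs   : Flat ℛ A.Carrier
        valid : lhs A.≈ flatValue A.spAlgebra id rhs

    Valuation : BAO ℛ → Set ℓ
    Valuation 𝔅 = A.Carrier → BAO.Carrier 𝔅

    Satisfies : (𝔅 : BAO ℛ) → Valuation 𝔅 → Equation → Set ℓ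
    Satisfies 𝔅 v (equation a f _) = v a ≈ flatValue reduct v f
      where open BAO 𝔅

    Forced : (∀ 𝔅 → Valuation 𝔅 → Set ℓ) → Set (lsuc ℓ ⊔ r)
    Forced P = ∃ λ Γ → ∀ 𝔅 → BAO.reduct 𝔅 ⊨ˢ rL → ∀ v → All (Satisfies 𝔅 v) Γ → P 𝔅 v

    Equal : Term ℛ A.Carrier → Term ℛ A.Carrier → ∀ 𝔅 → Valuation 𝔅 → Set ℓ
    Equal t u 𝔅 v = BAO._≈_ 𝔅 (value 𝔅 v t) (value 𝔅 v u)

    infix 4 _≈ᵗ_

    -- Forced lives in a large universe; excluded middle resizes it to Set ℓ.
    record _≈ᵗ_ (t u : Term ℛ A.Carrier) : Set ℓ where
      constructor resize
      field
        resized : True (em {P = Forced (Equal t u)})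

    forced⁺ : ∀ {t u} → Forced (Equal t u) → t ≈ᵗ u
    forced⁺ p = resize (fromWitness p)

    forced⁻ : ∀ {t u} → t ≈ᵗ u → Forced (Equal t u)
    forced⁻ (resize p) = toWitness p

    law : ∀ {t u} → (∀ 𝔅 v → Equal t u 𝔅 v) → t ≈ᵗ u
    law p = forced⁺ ([] , λ 𝔅 _ v _ → p 𝔅 v)

    law₁ : ∀ {t₁ u₁ t u} → (∀ 𝔅 v → Equal t₁ u₁ 𝔅 v → Equal t u 𝔅 v) →
           t₁ ≈ᵗ u₁ → t ≈ᵗ u
    law₁ p q with forced⁻ q
    ... | Γ , forces = forced⁺ (Γ , λ 𝔅 𝔅⊨rL v sat → p 𝔅 v (forces 𝔅 𝔅⊨rL v sat))

    law₂ : ∀ {t₁ u₁ t₂ u₂ t u} →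
           (∀ 𝔅 v → Equal t₁ u₁ 𝔅 v → Equal t₂ u₂ 𝔅 v → Equal t u 𝔅 v) →
           t₁ ≈ᵗ u₁ → t₂ ≈ᵗ u₂ → t ≈ᵗ u
    law₂ p q₁ q₂ with forced⁻ q₁ | forced⁻ q₂
    ... | Γ₁ , forces₁ | Γ₂ , forces₂ = forced⁺ (Γ₁ ++ Γ₂ , λ 𝔅 𝔅⊨rL v sat →
      p 𝔅 v (forces₁ 𝔅 𝔅⊨rL v (++⁻ˡ Γ₁ sat)) (forces₂ 𝔅 𝔅⊨rL v (++⁻ʳ Γ₁ sat)))

    fact : ∀ {t u} (eq : Equation) → (∀ 𝔅 v → Satisfies 𝔅 v eq → Equal t u 𝔅 v) → t ≈ᵗ u
    fact eq p = forced⁺ ([ eq ] , λ { 𝔅 _ v (sat ∷ []) → p 𝔅 v sat })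

    termBAO : BAO ℛ
    termBAO = record
      { Carrier = Term ℛ A.Carrier
      ; _≈_ = _≈ᵗ_
      ; _∧_ = _∧ᵗ_
      ; _∨_ = _∨ᵗ_
      ; -_  = -ᵗ_
      ; bot = ⊥ᵗ
      ; top = ⊤ᵗ
      ; ◇   = ◇ᵗ
      ; isBooleanAlgebra = record
        { isDistributiveLattice = record
          { isLattice = record
            { isEquivalence = record
              { refl  = law λ 𝔅 v → ≈-refl 𝔅
              ; sym   = law₁ λ 𝔅 v → ≈-sym 𝔅
              ; trans = law₂ λ 𝔅 v → ≈-trans 𝔅
              }
            ; ∨-comm     = λ t u → law λ 𝔅 v → ∨-comm 𝔅 _ _
            ; ∨-assoc    = λ t u s → law λ 𝔅 v → ∨-assoc 𝔅 _ _ _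
            ; ∨-cong     = law₂ λ 𝔅 v → ∨-cong 𝔅
            ; ∧-comm     = λ t u → law λ 𝔅 v → ∧-comm 𝔅 _ _
            ; ∧-assoc    = λ t u s → law λ 𝔅 v → ∧-assoc 𝔅 _ _ _
            ; ∧-cong     = law₂ λ 𝔅 v → ∧-cong 𝔅
            ; absorptive = (λ t u → law λ 𝔅 v → ∨-absorbs-∧ 𝔅 _ _)
                         , (λ t u → law λ 𝔅 v → ∧-absorbs-∨ 𝔅 _ _)
            }
          ; ∨-distrib-∧ = (λ t u s → law λ 𝔅 v → ∨-distribˡ-∧ 𝔅 _ _ _)
                        , (λ t u s → law λ 𝔅 v → ∨-distribʳ-∧ 𝔅 _ _ _)
          ; ∧-distrib-∨ = (λ t u s → law λ 𝔅 v → ∧-distribˡ-∨ 𝔅 _ _ _)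
                        , (λ t u s → law λ 𝔅 v → ∧-distribʳ-∨ 𝔅 _ _ _)
          }
        ; ∨-complement = (λ t → law λ 𝔅 v → ∨-complementˡ 𝔅 _)
                       , (λ t → law λ 𝔅 v → ∨-complementʳ 𝔅 _)
        ; ∧-complement = (λ t → law λ 𝔅 v → ∧-complementˡ 𝔅 _)
                       , (λ t → law λ 𝔅 v → ∧-complementʳ 𝔅 _)
        ; ¬-cong = law₁ λ 𝔅 v → ¬-cong 𝔅
        }
      ; ◇-cong = λ R → law₁ λ 𝔅 v → ◇-cong 𝔅 R
      ; ◇-bot  = λ R → law λ 𝔅 v → ◇-bot 𝔅 R
      ; ◇-join = λ R t u → law λ 𝔅 v → ◇-join 𝔅 R _ _
      }
      where open BAOProperties

    private module T = SpAlgebra (BAO.reduct termBAO)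

    value-⟦⟧ : ∀ 𝔅 (v : Valuation 𝔅) s φ →
               value 𝔅 v (T.⟦ φ ⟧ s) ≡ SpAlgebra.⟦_⟧ (BAO.reduct 𝔅) φ (value 𝔅 v ∘ s)
    value-⟦⟧ 𝔅 v s (var p)  = refl
    value-⟦⟧ 𝔅 v s ⊤ᶠ       = refl
    value-⟦⟧ 𝔅 v s (φ ∧ᶠ ψ) = cong₂ (BAO._∧_ 𝔅) (value-⟦⟧ 𝔅 v s φ) (value-⟦⟧ 𝔅 v s ψ)
    value-⟦⟧ 𝔅 v s (◇ᶠ R φ) = cong (BAO.◇ 𝔅 R) (value-⟦⟧ 𝔅 v s φ)

    HoldsAt : (ℕ → Term ℛ A.Carrier) → Implication ℛ → ∀ 𝔅 → Valuation 𝔅 → Set ℓ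
    HoldsAt s ι 𝔅 v = SpAlgebra.Holds (BAO.reduct 𝔅) (value 𝔅 v ∘ s) ι

    Holds⇒Forced : ∀ {s} ι → T.Holds s ι → Forced (HoldsAt s ι)
    Holds⇒Forced {s} (σ ⟶ τ) σ≤τ with forced⁻ σ≤τ
    ... | Γ , forces = Γ , λ 𝔅 𝔅⊨rL v sat →
      subst₂ (SpAlgebra._≤_ (BAO.reduct 𝔅)) (value-⟦⟧ 𝔅 v s σ) (value-⟦⟧ 𝔅 v s τ)
        (forces 𝔅 𝔅⊨rL v sat)

    Forced⇒Holds : ∀ {s} ι → Forced (HoldsAt s ι) → T.Holds s ι
    Forced⇒Holds {s} (σ ⟶ τ) (Γ , forces) = forced⁺ (Γ , λ 𝔅 𝔅⊨rL v sat →
      subst₂ (SpAlgebra._≤_ (BAO.reduct 𝔅)) (sym (value-⟦⟧ 𝔅 v s σ)) (sym (value-⟦⟧ 𝔅 v s τ))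
        (forces 𝔅 𝔅⊨rL v sat))

    All-Forced : ∀ {s ιs} → All (T.Holds s) ιs → Forced (λ 𝔅 v → All (λ ι → HoldsAt s ι 𝔅 v) ιs)
    All-Forced [] = [] , λ _ _ _ _ → []
    All-Forced {ιs = ι ∷ _} (p ∷ ps) with Holds⇒Forced ι p | All-Forced ps
    ... | Γ₁ , forces₁ | Γ₂ , forces₂ = Γ₁ ++ Γ₂ , λ 𝔅 𝔅⊨rL v sat →
      forces₁ 𝔅 𝔅⊨rL v (++⁻ˡ Γ₁ sat) ∷ forces₂ 𝔅 𝔅⊨rL v (++⁻ʳ Γ₁ sat)

    termBAO-⊨ˢ : BAO.reduct termBAO ⊨ˢ rL
    termBAO-⊨ˢ ρ ρ∈rL s premises with All-Forced premises
    ... | Γ , forces = Forced⇒Holds (Rule.conclusion ρ)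
      (Γ , λ 𝔅 𝔅⊨rL v sat → 𝔅⊨rL ρ ρ∈rL (value 𝔅 v ∘ s) (forces 𝔅 𝔅⊨rL v sat))

    support : List Equation → List A.Carrier
    support []                   = []
    support (equation a f _ ∷ Γ) = a ∷ elements f ++ support Γ

    encode : (A.Carrier → ℕ) → List Equation → List (Implication ℛ)
    encode i []                   = []
    encode i (equation a f _ ∷ Γ) =
      (var (i a) ⟶ flatFormula i f) ∷ (flatFormula i f ⟶ var (i a)) ∷ encode i Γ

    encode-sound : ∀ 𝔅 i 𝔟 Γ → All (SpAlgebra.Holds (BAO.reduct 𝔅) 𝔟) (encode i Γ) →
                   All (Satisfies 𝔅 (𝔟 ∘ i)) Γ
    encode-sound 𝔅 i 𝔟 []                   []               = []
    encode-sound 𝔅 i 𝔟 (equation a f _ ∷ Γ) (a≤f ∷ f≤a ∷ ps) =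
      subst (𝔟 (i a) ≈_) (⟦flatFormula⟧ reduct i 𝔟 f) (≤-antisym a≤f f≤a) ∷ encode-sound 𝔅 i 𝔟 Γ ps
      where open BAOProperties 𝔅

    encode-valid : ∀ i e Γ → All (λ x → e (i x) ≡ x) (support Γ) →
                   All (A.Holds e) (encode i Γ)
    encode-valid i e []                     []        = []
    encode-valid i e (equation a f a≈f ∷ Γ) (ea ∷ es) =
      A.≈-trans (A.∧-cong A.≈-refl (A.≈-sym ia≈f)) (A.idem _) ∷
      A.≈-trans (A.∧-cong A.≈-refl ia≈f) (A.idem _) ∷
      encode-valid i e Γ (++⁻ʳ (elements f) es)
      where
      ia≈f : e (i a) A.≈ A.⟦ flatFormula i f ⟧ e
      ia≈f = A.≈-trans (A.≈-reflexive ea) (A.≈-trans a≈f (A.≈-reflexive (sym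
        (trans (⟦flatFormula⟧ A.spAlgebra i e f)
               (flatValue-local A.spAlgebra f (++⁻ˡ (elements f) es))))))

    module _ (conservative : RuleConservative (BAOs ℛ) rL) (𝔄⊨rL : A.spAlgebra ⊨ˢ rL) where

      gen-reflects-≤ : ∀ {a b} → gen a ≈ᵗ gen b → a A.≤ b
      gen-reflects-≤ {a} {b} a≈b with forced⁻ a≈b
      ... | Γ , forces with index (a ∷ b ∷ support Γ) A.top
      ... | i , e , ea ∷ eb ∷ es =
        subst₂ A._≤_ ea eb (conservative ρ entailed 𝔄 𝔄⊨rL e (encode-valid i e Γ es))
        where
        ρ : Rule ℛ
        ρ = record { premises = encode i Γ ; conclusion = var (i a) ⟶ var (i b) }

        entailed : Entails (BAOs ℛ) rL ρ
        entailed 𝔅 𝔅⊨rL 𝔟 premises = BAOProperties.≤-reflexive 𝔅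
          (forces 𝔅 𝔅⊨rL (𝔟 ∘ i) (encode-sound 𝔅 i 𝔟 Γ premises))

      gen-injective : ∀ {a b} → gen a ≈ᵗ gen b → a A.≈ b
      gen-injective a≈b = A.≈-trans (A.≈-sym (gen-reflects-≤ a≈b))
        (A.≈-trans (A.comm _ _) (gen-reflects-≤ (BAOProperties.≈-sym termBAO a≈b)))

      gen-↪ : A.spAlgebra ↪ BAO.reduct termBAO
      gen-↪ = record
        { to = gen
        ; isMonoidMonomorphism = record
          { isMonoidHomomorphism = record
            { isMagmaHomomorphism = record
              { isRelHomomorphism = record
                { cong = λ {a} {b} a≈b → fact (equation a (el b) a≈b) λ _ _ → id }
              ; homo = λ a b → fact (equation (a A.∧ b) (and a b) A.≈-refl) λ _ _ → id
              }
            ; ε-homo = fact (equation A.top one A.≈-refl) λ _ _ → id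
            }
          ; injective = gen-injective
          }
        ; ◇-homo = λ R a → fact (equation (A.◇ R a) (dia R a) A.≈-refl) λ _ _ → id
        }

  BAO-conservative⇒embeddable : {ℛ : Set ℓ} (rL : Pred (Rule ℛ) r) →
    RuleConservative (BAOs ℛ) rL → Embeddable (BAOs ℛ) rL
  BAO-conservative⇒embeddable rL conservative 𝔄 𝔄⊨rL =
    termBAO , termBAO-⊨ˢ , gen-↪ conservative 𝔄⊨rL
    where open FreeExtension rL 𝔄

  module _ {ℛ : Set ℓ} (rL : Pred (Rule ℛ) r) where

    complex⇒globallyComplete : Complex em rL → GloballyComplete em rL
    complex⇒globallyComplete complex ρ entailed 𝔄 𝔄⊨rL with complex 𝔄 𝔄⊨rL
    ... | 𝔉 , 𝔉⋆⊨rL , 𝔄↪𝔉⋆ = ↪-⊨ (complexBAO em 𝔉) 𝔄↪𝔉⋆ ρ (entailed 𝔉 𝔉⋆⊨rL)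

    globallyComplete⇒BAO-conservative : GloballyComplete em rL → RuleConservative (BAOs ℛ) rL
    globallyComplete⇒BAO-conservative complete ρ entailed =
      complete ρ (λ 𝔉 → entailed (complexBAO em 𝔉))

    module _ (BAO-complex : BAO-Complex em rL) where

      BAO-conservative⇒globallyComplete : RuleConservative (BAOs ℛ) rL → GloballyComplete em rL
      BAO-conservative⇒globallyComplete conservative ρ entailed = conservative ρ λ 𝔅 𝔅⊨rL →
        let 𝔉 , 𝔉∈Kr , 𝔅↪𝔉⋆ = BAO-complex 𝔅 𝔅⊨rL
        in ↪-⊨ (complexBAO em 𝔉) 𝔅↪𝔉⋆ ρ (entailed 𝔉 (λ ρ′ ρ′∈rL → ⊩⇒⊨ em 𝔉 ρ′ (𝔉∈Kr ρ′ ρ′∈rL)))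

      BAO-embeddable⇒complex : Embeddable (BAOs ℛ) rL → Complex em rL
      BAO-embeddable⇒complex embeddable 𝔄 𝔄⊨rL =
        let 𝔅 , 𝔅⊨rL , 𝔄↪𝔅  = embeddable 𝔄 𝔄⊨rL
            𝔉 , 𝔉∈Kr , 𝔅↪𝔉⋆ = BAO-complex 𝔅 𝔅⊨rL
        in 𝔉 , (λ ρ ρ∈rL → ⊩⇒⊨ em 𝔉 ρ (𝔉∈Kr ρ ρ∈rL)) , ↪-trans (complexBAO em 𝔉) 𝔄↪𝔅 𝔅↪𝔉⋆

theorem9p12 : (em : ∀ {a} → ExcludedMiddle a) →
    ∀ {ℓ k} (ℛ : Set ℓ) (𝒦 : Pred (SLO ℛ) k) →
    BAO-Complex em (ruleLogic 𝒦) →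
    (Complex em (ruleLogic 𝒦) ⇔ GloballyComplete em (ruleLogic 𝒦)) ×
    (GloballyComplete em (ruleLogic 𝒦) ⇔ RuleConservative (BAOs ℛ) (ruleLogic 𝒦)) ×
    (RuleConservative (BAOs ℛ) (ruleLogic 𝒦) ⇔ Embeddable (BAOs ℛ) (ruleLogic 𝒦))
theorem9p12 em ℛ 𝒦 BAO-complex =
  mk⇔ i⇒ii (iv⇒i ∘ iii⇒iv ∘ ii⇒iii) , mk⇔ ii⇒iii iii⇒ii , mk⇔ iii⇒iv (ii⇒iii ∘ i⇒ii ∘ iv⇒i)
  where
  rL     = ruleLogic 𝒦
  i⇒ii   = complex⇒globallyComplete em rL
  ii⇒iii = globallyComplete⇒BAO-conservative em rL
  iii⇒ii = BAO-conservative⇒globallyComplete em rL BAO-complex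
  iii⇒iv = BAO-conservative⇒embeddable em rL
  iv⇒i   = BAO-embeddable⇒complex em rL BAO-complex
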